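{- For every integer $n\ge 1$, the poset $P^A_n$ is self-dual; that is, there is a bijection $\psi\colon P^A_n\to P^A_n$ such that for all $p,q\in P^A_n$, $p<q$ if and only if $\psi(q)<\psi(p)$.
   Context: Let $[n]=\{1,2,\dots,n\}$. A permutation $p=p_1p_2\cdots p_n$ of $[n]$ (one-line notation) is 132-avoiding if there are no positions $1\le a<b<c\le n$ with $p_a<p_c<p_b$. Its descent set is $\mathrm{Des}(p)=\{i\in[n-1] : p_i>p_{i+1}\}$. $P^A_n$ is the poset whose elements are the 132-avoiding permutations of $[n]$, with strict order $p<q$ if and only if $\mathrm{Des}(p)\subsetneq\mathrm{Des}(q)$ (so distinct permutations with the same descent set are incomparable). -}

module Defs where

open import Data.Fin.Base using (Fin; toℕ; _<_; _>_)
open import Data.Fin.Permutation using (Permutation′; _⟨$⟩ʳ_; _≈_)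
open import Data.Nat.Base using (ℕ; suc)
open import Data.Product.Base using (∃; ∃-syntax; Σ-syntax; _×_; _,_; proj₁)
open import Function.Base using (_on_)
open import Function.Bundles using (_⇔_; Bijection)
open import Level using (0ℓ; _⊔_)
open import Relation.Binary.Bundles using (StrictPartialOrder)
open import Relation.Binary.Core using (Rel)
open import Relation.Binary.PropositionalEquality
  using (_≡_; refl; sym; trans; subst₂)
open import Relation.Binary.Structures
  using (IsEquivalence; IsStrictPartialOrder)
open import Relation.Nullary using (¬_)
open import Relation.Unary using (Pred; _≐_; _⊆_; _⊂_)
open import Relation.Unary.Properties
  using (⊂-irrefl; ⊂-trans; ⊂-respˡ-≐; ⊂-respʳ-≐)

-- The element k of Fin n stands for k + 1 in [n], both as a position and as
-- a value.

Avoids132 : ∀ {n} → Permutation′ n → Set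
Avoids132 {n} p = ¬ (Σ[ a ∈ Fin n ] Σ[ b ∈ Fin n ] Σ[ c ∈ Fin n ]
  a < b × b < c × p ⟨$⟩ʳ a < p ⟨$⟩ʳ c × p ⟨$⟩ʳ c < p ⟨$⟩ʳ b)

-- The last position has no successor j in Fin n, so it is never a descent and
-- Des p is contained in [n - 1].

Des : ∀ {n} → Permutation′ n → Pred (Fin n) 0ℓ
Des p i = ∃[ j ] toℕ j ≡ suc (toℕ i) × p ⟨$⟩ʳ i > p ⟨$⟩ʳ j

Av132 : ℕ → Set
Av132 n = ∃ (Avoids132 {n})

-- Elements are compared as functions, ignoring the proof components.

infix 4 _≈ᴾ_ _<ᴾ_

_≈ᴾ_ : ∀ {n} → Rel (Av132 n) 0ℓ
_≈ᴾ_ = _≈_ on proj₁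

_<ᴾ_ : ∀ {n} → Rel (Av132 n) 0ℓ
(p , _) <ᴾ (q , _) = Des p ⊂ Des q

≈ᴾ-isEquivalence : ∀ {n} → IsEquivalence (_≈ᴾ_ {n})
≈ᴾ-isEquivalence = record
  { refl  = λ _ → refl
  ; sym   = λ p≈q i → sym (p≈q i)
  ; trans = λ p≈q q≈r i → trans (p≈q i) (q≈r i)
  }

Des-cong : ∀ {n} {p q : Permutation′ n} → p ≈ q → Des p ≐ Des q
Des-cong {n} {p} {q} p≈q = ⊆-from p q p≈q , ⊆-from q p (λ i → sym (p≈q i))
  where
  ⊆-from : ∀ (p q : Permutation′ n) → p ≈ q → Des p ⊆ Des q
  ⊆-from p q p≈q {i} (j , j≡1+i , pj<pi) =
    j , j≡1+i , subst₂ _<_ (p≈q j) (p≈q i) pj<pi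

<ᴾ-isStrictPartialOrder : ∀ {n} → IsStrictPartialOrder (_≈ᴾ_ {n}) _<ᴾ_
<ᴾ-isStrictPartialOrder = record
  { isEquivalence = ≈ᴾ-isEquivalence
  ; irrefl        = λ {p} {q} p≈q → ⊂-irrefl (des-cong p q p≈q)
  ; trans         = ⊂-trans
  ; <-resp-≈      = (λ {p} {q} {r} q≈r → ⊂-respʳ-≐ (des-cong q r q≈r))
                  , (λ {p} {q} {r} q≈r → ⊂-respˡ-≐ (des-cong q r q≈r))
  }
  where
  des-cong : ∀ {n} (p q : Av132 n) → p ≈ᴾ q → Des (proj₁ p) ≐ Des (proj₁ q)
  des-cong p q = Des-cong {p = proj₁ p} {q = proj₁ q}

Pᴬ : ℕ → StrictPartialOrder 0ℓ 0ℓ 0ℓ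
Pᴬ n = record
  { Carrier              = Av132 n
  ; _≈_                  = _≈ᴾ_
  ; _<_                  = _<ᴾ_
  ; isStrictPartialOrder = <ᴾ-isStrictPartialOrder
  }

SelfDual : ∀ {c ℓ₁ ℓ₂} → StrictPartialOrder c ℓ₁ ℓ₂ → Set (c ⊔ ℓ₁ ⊔ ℓ₂)
SelfDual P = Σ[ ψ ∈ Bijection P.Eq.setoid P.Eq.setoid ]
  (∀ p q → p P.< q ⇔ Bijection.to ψ q P.< Bijection.to ψ p)
  where module P = StrictPartialOrder P

{-# OPTIONS --safe #-}
module Submission where

-- Call j a left maximum of the window [i, j] of f when f k < f j for all other
-- positions k of the window, and i a right maximum when f k < f i for all of
-- them.  For i < j and a 132-avoiding p, p i < p j holds exactly when j is a left
-- maximum of [i, j], so p is determined by its left maxima.  Conversely every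
-- injective f has a 132-avoiding normalisation with the same left maxima, and it
-- also has the same right maxima as f.  Let ψ p be the normalisation of the
-- reversal of p.  Reversal exchanges left and right maxima, hence ψ is an
-- involution; and a window of length two shows that i is a descent of ψ p iff
-- n - i (in the numbering of [n]) is not a descent of p.

open import Defs
open import Data.Fin.Base using (Fin; toℕ; fromℕ<; opposite; punchOut; _<_; _≤_)
open import Data.Fin.Induction using (<-wellFounded; >-wellFounded)
open import Data.Fin.Permutation
  using (Permutation′; permutation; _⟨$⟩ʳ_; _⟨$⟩ˡ_; _≈_; inverseˡ; inverseʳ)
open import Data.Fin.Properties
  using (_≟_; _<?_; _≤?_; <-cmp; <-irrefl; <-asym; all?; any?; toℕ<n; toℕ-fromℕ<
        ; toℕ-injective; injective⇒≤; punchOut-injective; opposite-prop; opposite-involutive)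
open import Data.Fin.Subset using (Subset; _∈_; _⊂_; ∣_∣; ⊤)
open import Data.Fin.Subset.Properties using (⊆⊤; ∈⊤; ∣⊤∣≡n; p⊂q⇒∣p∣<∣q∣)
open import Data.Nat.Base as ℕ using (ℕ; _≥_)
import Data.Nat.Properties as ℕ
open import Data.Product.Base using (∃; _×_; _,_; proj₁; proj₂)
open import Data.Sum.Base using (_⊎_; inj₁; inj₂)
open import Data.Vec.Base using (tabulate)
open import Data.Vec.Properties using (lookup∘tabulate; lookup⇒[]=; []=⇒lookup)
open import Function.Base using (_∘_; flip)
open import Function.Bundles using (_⇔_; mk⇔; Equivalence; Inverse)
open import Function.Definitions using (Injective)
open import Function.Properties.Inverse using (Inverse⇒Bijection)
open import Induction.WellFounded using (Acc; acc)
open import Level using (0ℓ)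
open import Relation.Binary.Bundles using (StrictPartialOrder)
open import Relation.Binary.Core using (Rel)
open import Relation.Binary.Definitions using (tri<; tri≈; tri>; Transitive; Trichotomous)
open import Relation.Binary.PropositionalEquality
open import Relation.Binary.Structures using (IsStrictTotalOrder)
open import Relation.Binary.Structures.Biased using (isStrictTotalOrderᶜ)
open import Relation.Nullary using (Dec; yes; no; does; ¬_; contradiction)
open import Relation.Nullary.Decidable using (_→-dec_; dec-true)
open import Relation.Unary using (_⊆_)

private
  variable
    n : ℕ

-- Permutations from injections of a finite set.

injective⇒surjective : ∀ {f : Fin n → Fin n} → Injective _≡_ _≡_ f → ∀ y → ∃ λ x → f x ≡ y
injective⇒surjective {ℕ.suc n} {f} inj y with any? (λ x → f x ≟ y)
... | yes hit = hit
-- Pigeonhole: punching out the missed value `y` would inject `n + 1` elements into `n`.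
... | no miss = contradiction (injective⇒≤ {f = λ x → punchOut (y≢f x)} inj′) ℕ.1+n≰n
  where
  y≢f : ∀ x → y ≢ f x
  y≢f x y≡fx = miss (x , sym y≡fx)
  inj′ : Injective _≡_ _≡_ (λ x → punchOut (y≢f x))
  inj′ {i} {j} eq = inj (punchOut-injective (y≢f i) (y≢f j) eq)

injective⇒permutation : (f : Fin n → Fin n) → Injective _≡_ _≡_ f → Permutation′ n
injective⇒permutation f inj = permutation f (proj₁ ∘ surj) (proj₂ ∘ surj)
  (λ x → inj (proj₂ (surj (f x))))
  where surj = injective⇒surjective inj

⟨$⟩ʳ-injective : (p : Permutation′ n) → Injective _≡_ _≡_ (p ⟨$⟩ʳ_)
⟨$⟩ʳ-injective p {i} {j} eq =
  trans (sym (inverseˡ p)) (trans (cong (p ⟨$⟩ˡ_) eq) (inverseˡ p))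

-- Ranks in a finite strict total order.

module Rank {_≺_ : Rel (Fin n) 0ℓ} (isSTO : IsStrictTotalOrder _≡_ _≺_) where

  open IsStrictTotalOrder isSTO using (compare; irrefl)
    renaming (_<?_ to _≺?_; trans to ≺-trans)

  below : Fin n → Subset n
  below j = tabulate (λ i → does (i ≺? j))

  ∈-below⁺ : ∀ {i j} → i ≺ j → i ∈ below j
  ∈-below⁺ {i} {j} i≺j = lookup⇒[]= i (below j)
    (trans (lookup∘tabulate _ i) (dec-true (i ≺? j) i≺j))

  ∈-below⁻ : ∀ {i j} → i ∈ below j → i ≺ j
  ∈-below⁻ {i} {j} i∈ with i ≺? j | trans (sym (lookup∘tabulate _ i)) ([]=⇒lookup i∈)
  ... | yes i≺j | _ = i≺j

  below-⊂ : ∀ {i j} → i ≺ j → below i ⊂ below j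
  below-⊂ i≺j = (λ k∈ → ∈-below⁺ (≺-trans (∈-below⁻ k∈) i≺j))
    , _ , ∈-below⁺ i≺j , irrefl refl ∘ ∈-below⁻

  -- By irreflexivity `i` itself is missing, so the count is a legal value in `Fin n`.
  ∣below∣<n : ∀ i → ∣ below i ∣ ℕ.< n
  ∣below∣<n i = subst (∣ below i ∣ ℕ.<_) (∣⊤∣≡n n)
    (p⊂q⇒∣p∣<∣q∣ (⊆⊤ , i , ∈⊤ , irrefl refl ∘ ∈-below⁻))

  rank : Fin n → Fin n
  rank i = fromℕ< (∣below∣<n i)

  rank-mono : ∀ {i j} → i ≺ j → rank i < rank j
  rank-mono {i} {j} i≺j = subst₂ ℕ._<_
    (sym (toℕ-fromℕ< (∣below∣<n i))) (sym (toℕ-fromℕ< (∣below∣<n j)))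
    (p⊂q⇒∣p∣<∣q∣ (below-⊂ i≺j))

  rank-injective : Injective _≡_ _≡_ rank
  rank-injective {i} {j} eq with compare i j
  ... | tri< i≺j _ _ = contradiction (rank-mono i≺j) (<-irrefl eq)
  ... | tri≈ _ i≡j _ = i≡j
  ... | tri> _ _ j≺i = contradiction (rank-mono j≺i) (<-irrefl (sym eq))

  rank-cancel : ∀ {i j} → rank i < rank j → i ≺ j
  rank-cancel {i} {j} ri<rj with compare i j
  ... | tri< i≺j _ _ = i≺j
  ... | tri≈ _ refl _ = contradiction ri<rj (<-irrefl refl)
  ... | tri> _ _ j≺i = contradiction (rank-mono j≺i) (<-asym ri<rj)

  rankₚ : Permutation′ n
  rankₚ = injective⇒permutation rank rank-injective

-- Permutations are determined by their ascending pairs.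

mono⇒≤ : (p q : Permutation′ n) →
         (∀ i j → p ⟨$⟩ʳ i < p ⟨$⟩ʳ j → q ⟨$⟩ʳ i < q ⟨$⟩ʳ j) →
         ∀ i → p ⟨$⟩ʳ i ≤ q ⟨$⟩ʳ i
mono⇒≤ {n} p q mono i = go i (<-wellFounded _)
  where
  go : ∀ i → Acc _<_ (p ⟨$⟩ʳ i) → p ⟨$⟩ʳ i ≤ q ⟨$⟩ʳ i
  go i (acc rec) with q ⟨$⟩ʳ i <? p ⟨$⟩ʳ i
  ... | no qi≮pi = ℕ.≮⇒≥ qi≮pi
  -- Let `k` be the position where `p` takes the smaller value `q i`. Induction gives
  -- `q i = p k ≤ q k`, while `p k < p i` forces `q k < q i`.
  ... | yes qi<pi = contradiction
    (ℕ.≤-<-trans (subst (_≤ q ⟨$⟩ʳ k) pk≡qi (go k (rec pk<pi))) (mono k i pk<pi)) (ℕ.<-irrefl refl)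
    where
    k : Fin n
    k = p ⟨$⟩ˡ (q ⟨$⟩ʳ i)
    pk≡qi : p ⟨$⟩ʳ k ≡ q ⟨$⟩ʳ i
    pk≡qi = inverseʳ p
    pk<pi : p ⟨$⟩ʳ k < p ⟨$⟩ʳ i
    pk<pi = subst (_< p ⟨$⟩ʳ i) (sym pk≡qi) qi<pi

ascents⇒mono : (p q : Permutation′ n) →
               (∀ i j → i < j → p ⟨$⟩ʳ i < p ⟨$⟩ʳ j ⇔ q ⟨$⟩ʳ i < q ⟨$⟩ʳ j) →
               ∀ i j → p ⟨$⟩ʳ i < p ⟨$⟩ʳ j → q ⟨$⟩ʳ i < q ⟨$⟩ʳ j
ascents⇒mono p q same i j pi<pj with <-cmp i j
... | tri< i<j _ _ = Equivalence.to (same i j i<j) pi<pj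
... | tri≈ _ refl _ = contradiction pi<pj (ℕ.<-irrefl refl)
... | tri> _ i≢j j<i with <-cmp (q ⟨$⟩ʳ i) (q ⟨$⟩ʳ j)
...   | tri< qi<qj _ _ = qi<qj
...   | tri≈ _ qi≡qj _ = contradiction (⟨$⟩ʳ-injective q qi≡qj) i≢j
...   | tri> _ _ qj<qi = contradiction (Equivalence.from (same j i j<i) qj<qi) (ℕ.<-asym pi<pj)

ascents⇒≈ : (p q : Permutation′ n) →
            (∀ i j → i < j → p ⟨$⟩ʳ i < p ⟨$⟩ʳ j ⇔ q ⟨$⟩ʳ i < q ⟨$⟩ʳ j) → p ≈ q
ascents⇒≈ p q same i = toℕ-injective (ℕ.≤-antisym
  (mono⇒≤ p q (ascents⇒mono p q same) i)
  (mono⇒≤ q p (ascents⇒mono q p λ i j i<j →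
    mk⇔ (Equivalence.from (same i j i<j)) (Equivalence.to (same i j i<j))) i))

-- Window maxima and the 132-avoiding normalisation.

LeftMax RightMax : (Fin n → Fin n) → Rel (Fin n) 0ℓ
LeftMax  f i j = ∀ k → i ≤ k → k < j → f k < f j
RightMax f i j = ∀ k → i < k → k ≤ j → f k < f i

leftMax? : ∀ (f : Fin n → Fin n) i j → Dec (LeftMax f i j)
leftMax? f i j = all? λ k → (i ≤? k) →-dec ((k <? j) →-dec (f k <? f j))

module _ (f : Fin n → Fin n) where

  leftMax-shrink : ∀ {i j k} → i ≤ j → LeftMax f i k → LeftMax f j k
  leftMax-shrink i≤j max m j≤m = max m (ℕ.≤-trans i≤j j≤m)

  leftMax-trans : ∀ {i j k} → j < k → LeftMax f i j → LeftMax f j k → LeftMax f i k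
  leftMax-trans {i} {j} {k} j<k maxⱼ maxₖ m i≤m m<k with m <? j
  ... | yes m<j = ℕ.<-trans (maxⱼ m i≤m m<j) (maxₖ j ℕ.≤-refl j<k)
  ... | no  m≮j = maxₖ m (ℕ.≮⇒≥ m≮j) m<k

  -- The order of values forced on a 132-avoiding permutation with the left maxima of f.
  _≺_ : Rel (Fin n) 0ℓ
  i ≺ j = (i < j × LeftMax f i j) ⊎ (j < i × ¬ LeftMax f j i)

  -- Every case either glues two windows at a common end or shrinks one from the left; when the two
  -- comparisons point in different directions, the relative position of `i` and `k` decides which.
  ≺-trans : Transitive _≺_
  ≺-trans {i} {j} {k} (inj₁ (i<j , ij)) (inj₁ (j<k , jk)) =
    inj₁ (ℕ.<-trans i<j j<k , leftMax-trans j<k ij jk)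
  ≺-trans {i} {j} {k} (inj₁ (i<j , ij)) (inj₂ (k<j , ¬kj)) with <-cmp i k
  ... | tri< i<k _ _ = contradiction (leftMax-shrink (ℕ.<⇒≤ i<k) ij) ¬kj
  ... | tri≈ _ refl _ = contradiction ij ¬kj
  ... | tri> _ _ k<i = inj₂ (k<i , λ ki → ¬kj (leftMax-trans i<j ki ij))
  ≺-trans {i} {j} {k} (inj₂ (j<i , ¬ji)) (inj₁ (j<k , jk)) with <-cmp i k
  ... | tri< i<k _ _ = inj₁ (i<k , leftMax-shrink (ℕ.<⇒≤ j<i) jk)
  ... | tri≈ _ refl _ = contradiction jk ¬ji
  ... | tri> _ _ k<i = inj₂ (k<i , λ ki → ¬ji (leftMax-trans k<i jk ki))
  ≺-trans {i} {j} {k} (inj₂ (j<i , ¬ji)) (inj₂ (k<j , ¬kj)) =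
    inj₂ (ℕ.<-trans k<j j<i , λ ki → ¬ji (leftMax-shrink (ℕ.<⇒≤ k<j) ki))

  ≺⇒leftMax : ∀ {i j} → i < j → i ≺ j → LeftMax f i j
  ≺⇒leftMax i<j (inj₁ (_ , max)) = max
  ≺⇒leftMax i<j (inj₂ (j<i , _)) = contradiction j<i (ℕ.<-asym i<j)

  ≻⇒¬leftMax : ∀ {i j} → i < j → j ≺ i → ¬ LeftMax f i j
  ≻⇒¬leftMax i<j (inj₁ (j<i , _)) = contradiction j<i (ℕ.<-asym i<j)
  ≻⇒¬leftMax i<j (inj₂ (_ , ¬max)) = ¬max

  ≺-irrefl : ∀ {i} → ¬ i ≺ i
  ≺-irrefl (inj₁ (i<i , _)) = ℕ.<-irrefl refl i<i
  ≺-irrefl (inj₂ (i<i , _)) = ℕ.<-irrefl refl i<i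

  ≺-compare : Trichotomous _≡_ _≺_
  ≺-compare i j with <-cmp i j
  ... | tri≈ _ refl _ = tri≈ ≺-irrefl refl ≺-irrefl
  ... | tri< i<j i≢j _ with leftMax? f i j
  ...   | yes max = tri< (inj₁ (i<j , max)) i≢j λ j≺i → ≻⇒¬leftMax i<j j≺i max
  ...   | no ¬max = tri> (¬max ∘ ≺⇒leftMax i<j) i≢j (inj₂ (i<j , ¬max))
  ≺-compare i j | tri> _ i≢j j<i with leftMax? f j i
  ...   | yes max = tri> (λ i≺j → ≻⇒¬leftMax j<i i≺j max) i≢j (inj₁ (j<i , max))
  ...   | no ¬max = tri< (inj₂ (j<i , ¬max)) i≢j (¬max ∘ ≺⇒leftMax j<i)

  ≺-isStrictTotalOrder : IsStrictTotalOrder _≡_ _≺_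
  ≺-isStrictTotalOrder = isStrictTotalOrderᶜ record
    { isEquivalence = isEquivalence
    ; trans         = ≺-trans
    ; compare       = ≺-compare
    }

  open Rank ≺-isStrictTotalOrder

  normalise : Permutation′ n
  normalise = rankₚ

  normalise-ascent : ∀ {i j} → i < j → normalise ⟨$⟩ʳ i < normalise ⟨$⟩ʳ j ⇔ LeftMax f i j
  normalise-ascent i<j =
    mk⇔ (≺⇒leftMax i<j ∘ rank-cancel) (λ max → rank-mono (inj₁ (i<j , max)))

  -- If `a` lies below `c`, then `c` is a left maximum of `[a, c]`, hence of `[b, c]`, which puts
  -- `b` below `c` as well.
  normalise-avoids132 : Avoids132 normalise
  normalise-avoids132 (a , b , c , a<b , b<c , pa<pc , pc<pb) =
    ≻⇒¬leftMax b<c (rank-cancel pc<pb)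
      (leftMax-shrink (ℕ.<⇒≤ a<b) (≺⇒leftMax (ℕ.<-trans a<b b<c) (rank-cancel pa<pc)))

-- A position strictly between `i` and `j` with value above `p j` would complete a 132 pattern with
-- `i` and `j`.
avoids132⇒leftMax : ((p , _) : Av132 n) → ∀ {i j} → i < j →
                    p ⟨$⟩ʳ i < p ⟨$⟩ʳ j ⇔ LeftMax (p ⟨$⟩ʳ_) i j
avoids132⇒leftMax (p , avoids) {i} {j} i<j =
  mk⇔ leftMax (λ max → max i ℕ.≤-refl i<j)
  where
  leftMax : p ⟨$⟩ʳ i < p ⟨$⟩ʳ j → LeftMax (p ⟨$⟩ʳ_) i j
  leftMax pi<pj k i≤k k<j with <-cmp (p ⟨$⟩ʳ k) (p ⟨$⟩ʳ j) | <-cmp i k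
  ... | tri< pk<pj _ _ | _ = pk<pj
  ... | tri≈ _ pk≡pj _ | _ =
    contradiction (cong toℕ (⟨$⟩ʳ-injective p pk≡pj)) (ℕ.<⇒≢ k<j)
  ... | tri> _ _ pj<pk | tri< i<k _ _ = contradiction (i , k , j , i<k , k<j , pi<pj , pj<pk) avoids
  ... | tri> _ _ pj<pk | tri≈ _ refl _ = pi<pj
  ... | tri> _ _ _     | tri> _ _ k<i = contradiction i≤k (ℕ.<⇒≱ k<i)

-- Reversal of positions.

opposite-mono-< : ∀ {i j : Fin n} → i < j → opposite j < opposite i
opposite-mono-< {n} {i} {j} i<j = subst₂ ℕ._<_
  -- Truncated subtraction from `n` is strictly decreasing only up to `n`, hence the bound on `j`.
  (sym (opposite-prop j)) (sym (opposite-prop i)) (ℕ.∸-monoʳ-< (ℕ.s<s i<j) (toℕ<n j))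

opposite-mono-≤ : ∀ {i j : Fin n} → i ≤ j → opposite j ≤ opposite i
opposite-mono-≤ {n} {i} {j} i≤j = subst₂ ℕ._≤_
  (sym (opposite-prop j)) (sym (opposite-prop i)) (ℕ.∸-monoʳ-≤ n (ℕ.s≤s i≤j))

opposite-adjacent : ∀ {i j : Fin n} → toℕ j ≡ ℕ.suc (toℕ i) →
                    toℕ (opposite i) ≡ ℕ.suc (toℕ (opposite j))
opposite-adjacent {n} {i} {j} j≡1+i = begin
  toℕ (opposite i)          ≡⟨ opposite-prop i ⟩
  n ℕ.∸ ℕ.suc (toℕ i)       ≡⟨ cong (n ℕ.∸_) j≡1+i ⟨
  n ℕ.∸ toℕ j               ≡⟨ ℕ.+-∸-assoc 1 (toℕ<n j) ⟩
  ℕ.suc (n ℕ.∸ ℕ.suc (toℕ j)) ≡⟨ cong ℕ.suc (opposite-prop j) ⟨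
  ℕ.suc (toℕ (opposite j))  ∎
  where open ≡-Reasoning

-- Reflection carries the window `[i, j]` onto `[opposite j, opposite i]` and makes its left end the
-- right end.
leftMax-opposite : ∀ (f : Fin n → Fin n) {i j} →
                   LeftMax (f ∘ opposite) (opposite j) (opposite i) ⇔ RightMax f i j
leftMax-opposite f {i} {j} = mk⇔
  (λ max k i<k k≤j → subst₂ (λ x y → f x < f y)
    (opposite-involutive k) (opposite-involutive i)
    (max (opposite k) (opposite-mono-≤ k≤j) (opposite-mono-< i<k)))
  (λ max k j′≤k k<i′ → subst (λ x → f (opposite k) < f x) (sym (opposite-involutive i))
    (max (opposite k)
      (subst (_< opposite k) (opposite-involutive i) (opposite-mono-< k<i′))
      (subst (opposite k ≤_) (opposite-involutive j) (opposite-mono-≤ j′≤k))))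

-- The mirror image and its window maxima.

mirror : Permutation′ n → Permutation′ n
mirror p = normalise ((p ⟨$⟩ʳ_) ∘ opposite)

mirror-ascent : ∀ (p : Permutation′ n) {i j} → i < j →
                mirror p ⟨$⟩ʳ opposite j < mirror p ⟨$⟩ʳ opposite i ⇔ RightMax (p ⟨$⟩ʳ_) i j
mirror-ascent p i<j = mk⇔
  (Equivalence.to (leftMax-opposite (p ⟨$⟩ʳ_)) ∘ Equivalence.to asc)
  (Equivalence.from asc ∘ Equivalence.from (leftMax-opposite (p ⟨$⟩ʳ_)))
  where asc = normalise-ascent ((p ⟨$⟩ʳ_) ∘ opposite) (opposite-mono-< i<j)

-- Were the mirrored value at `k` above that at `j`, then `k` would be a right maximum of `[k, j]`
-- in `p`, so `p j < p k`.
leftMax⇒mirror : ∀ (p : Permutation′ n) {i j} → LeftMax (p ⟨$⟩ʳ_) i j →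
                 LeftMax ((mirror p ⟨$⟩ʳ_) ∘ opposite) i j
leftMax⇒mirror p {i} {j} max k i≤k k<j
  with <-cmp (mirror p ⟨$⟩ʳ opposite k) (mirror p ⟨$⟩ʳ opposite j)
... | tri< lt _ _ = lt
... | tri≈ _ eq _ = contradiction (opposite-mono-< k<j)
  (ℕ.<-irrefl (cong toℕ (sym (⟨$⟩ʳ-injective (mirror p) eq))))
... | tri> _ _ gt = contradiction (max k i≤k k<j)
  (ℕ.<-asym (Equivalence.to (mirror-ascent p k<j) gt j k<j ℕ.≤-refl))

-- The rightmost k in [i, j) with p k > p j would be a right maximum of [k, j],
-- so the mirror image would have its value at j above the one at k.
mirror⇒leftMax : ∀ (p : Permutation′ n) {i j} →
                 LeftMax ((mirror p ⟨$⟩ʳ_) ∘ opposite) i j → LeftMax (p ⟨$⟩ʳ_) i j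
mirror⇒leftMax {n} p {i} {j} max k = go k (>-wellFounded k)
  where
  go : ∀ k → Acc (flip _<_) k → i ≤ k → k < j → p ⟨$⟩ʳ k < p ⟨$⟩ʳ j
  go k (acc rec) i≤k k<j with <-cmp (p ⟨$⟩ʳ k) (p ⟨$⟩ʳ j)
  ... | tri< pk<pj _ _ = pk<pj
  ... | tri≈ _ pk≡pj _ = contradiction (cong toℕ (⟨$⟩ʳ-injective p pk≡pj)) (ℕ.<⇒≢ k<j)
  ... | tri> _ _ pj<pk = contradiction (max k i≤k k<j)
    (ℕ.<-asym (Equivalence.from (mirror-ascent p k<j) rightMax))
    where
    rightMax : RightMax (p ⟨$⟩ʳ_) k j
    rightMax m k<m m≤j with m <? j
    ... | yes m<j = ℕ.<-trans (go m (rec k<m) (ℕ.≤-trans i≤k (ℕ.<⇒≤ k<m)) m<j) pj<pk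
    ... | no  m≮j = subst (λ x → p ⟨$⟩ʳ x < p ⟨$⟩ʳ k)
      (toℕ-injective (ℕ.≤-antisym (ℕ.≮⇒≥ m≮j) m≤j)) pj<pk

-- The involution on 132-avoiding permutations.

ψ : Av132 n → Av132 n
ψ (p , _) = mirror p , normalise-avoids132 ((p ⟨$⟩ʳ_) ∘ opposite)

ψ-cong : ∀ {p q : Av132 n} → p ≈ᴾ q → ψ p ≈ᴾ ψ q
ψ-cong {n} {p , _} {q , _} p≈q = ascents⇒≈ (mirror p) (mirror q) λ i j i<j → mk⇔
  (transfer p q p≈q i<j) (transfer q p (sym ∘ p≈q) i<j)
  where
  transfer : ∀ (p q : Permutation′ n) → p ≈ q → ∀ {i j} → i < j →
             mirror p ⟨$⟩ʳ i < mirror p ⟨$⟩ʳ j → mirror q ⟨$⟩ʳ i < mirror q ⟨$⟩ʳ j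
  transfer p q p≈q i<j lt = Equivalence.from (normalise-ascent _ i<j)
    λ k i≤k k<j → subst₂ _<_ (p≈q _) (p≈q _) (Equivalence.to (normalise-ascent _ i<j) lt k i≤k k<j)

-- Ascending pairs of the double mirror image are the left maxima of the reversed mirror image,
-- which are those of `p`; as `p` avoids 132, these are its ascending pairs.
ψ-involutive : ∀ (p : Av132 n) → ψ (ψ p) ≈ᴾ p
ψ-involutive (p , avoids) = ascents⇒≈ (mirror (mirror p)) p λ i j i<j → mk⇔
  (Equivalence.from (avoids132⇒leftMax (p , avoids) i<j)
    ∘ mirror⇒leftMax p ∘ Equivalence.to (normalise-ascent _ i<j))
  (Equivalence.from (normalise-ascent _ i<j)
    ∘ leftMax⇒mirror p ∘ Equivalence.to (avoids132⇒leftMax (p , avoids) i<j))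

ψ-selfInverse : ∀ (p q : Av132 n) → p ≈ᴾ ψ q → ψ p ≈ᴾ q
ψ-selfInverse p q p≈ψq i = trans (ψ-cong {p = p} {ψ q} p≈ψq i) (ψ-involutive q i)

-- Descent sets under mirroring.

adjacent-leftMax : ∀ (f : Fin n → Fin n) {i j} → toℕ j ≡ ℕ.suc (toℕ i) →
                   LeftMax f i j ⇔ f i < f j
adjacent-leftMax f {i} {j} j≡1+i = mk⇔
  (λ max → max i ℕ.≤-refl (ℕ.≤-reflexive (sym j≡1+i)))
  (λ fi<fj k i≤k k<j → subst (λ x → f x < f j)
    (toℕ-injective (ℕ.≤-antisym i≤k (ℕ.s≤s⁻¹ (subst (toℕ k ℕ.<_) j≡1+i k<j)))) fi<fj)

-- Reversal swaps the two neighbours, so the descent of `p` starts at `opposite j`, one place before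
-- `opposite i`.
mirror-adjacent-ascent : ∀ (p : Permutation′ n) {i j} → toℕ j ≡ ℕ.suc (toℕ i) →
                         mirror p ⟨$⟩ʳ i < mirror p ⟨$⟩ʳ j ⇔ Des p (opposite j)
mirror-adjacent-ascent p {i} {j} j≡1+i = mk⇔
  (λ lt → opposite i , opposite-adjacent j≡1+i , Equivalence.to adj (Equivalence.to asc lt))
  (λ (k , k≡1+j′ , pk<pj′) → Equivalence.from asc (Equivalence.from adj
    (subst (λ x → p ⟨$⟩ʳ x < p ⟨$⟩ʳ opposite j)
      (toℕ-injective (trans k≡1+j′ (sym (opposite-adjacent j≡1+i)))) pk<pj′)))
  where
  adj = adjacent-leftMax ((p ⟨$⟩ʳ_) ∘ opposite) j≡1+i
  asc = normalise-ascent ((p ⟨$⟩ʳ_) ∘ opposite) (ℕ.≤-reflexive (sym j≡1+i))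

-- An ascent of `mirror p` at `i` would be a reflected descent of `p`, hence of `q`, and so an
-- ascent of `mirror q` at `i`. Values are distinct, so only a descent remains.
mirror-antitone : ∀ (p q : Permutation′ n) → Des p ⊆ Des q → Des (mirror q) ⊆ Des (mirror p)
mirror-antitone p q p⊆q {i} (j , j≡1+i , desc) with <-cmp (mirror p ⟨$⟩ʳ i) (mirror p ⟨$⟩ʳ j)
... | tri> _ _ gt = j , j≡1+i , gt
... | tri≈ _ eq _ = contradiction (cong toℕ (⟨$⟩ʳ-injective (mirror p) eq))
  (ℕ.<⇒≢ (ℕ.≤-reflexive (sym j≡1+i)))
... | tri< lt _ _ = contradiction
  (Equivalence.from (mirror-adjacent-ascent q j≡1+i)
    (p⊆q (Equivalence.to (mirror-adjacent-ascent p j≡1+i) lt)))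
  (ℕ.<-asym desc)

-- Mirroring once more reverses the inclusion again, and the involution returns to `p` and `q`.
mirror-reflects : ∀ ((p , _) (q , _) : Av132 n) →
                  Des (mirror q) ⊆ Des (mirror p) → Des p ⊆ Des q
mirror-reflects P@(p , _) Q@(q , _) ψq⊆ψp =
  proj₁ (Des-cong {p = mirror (mirror q)} {q} (ψ-involutive Q))
  ∘ mirror-antitone (mirror q) (mirror p) ψq⊆ψp
  ∘ proj₂ (Des-cong {p = mirror (mirror p)} {p} (ψ-involutive P))

theorem2 : ∀ (n : ℕ) → n ≥ 1 → SelfDual (Pᴬ n)
theorem2 n _ = Inverse⇒Bijection ψ-inverse , λ P@(p , _) Q@(q , _) → mk⇔
  -- Strict inclusion pairs an inclusion with a failed converse; the failure is transported
  -- contrapositively, by the implication in the opposite direction.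
  (λ (p⊆q , q⊈p) → mirror-antitone p q p⊆q , q⊈p ∘ mirror-reflects Q P)
  (λ (ψq⊆ψp , ψp⊈ψq) → mirror-reflects P Q ψq⊆ψp , ψp⊈ψq ∘ mirror-antitone q p)
  where
  open StrictPartialOrder (Pᴬ n) using (module Eq)
  ψ-inverse : Inverse Eq.setoid Eq.setoid
  ψ-inverse = record
    { to        = ψ
    ; from      = ψ
    ; to-cong   = λ {p} {q} → ψ-cong {p = p} {q}
    ; from-cong = λ {p} {q} → ψ-cong {p = p} {q}
    ; inverse   = (λ {q} {p} → ψ-selfInverse p q) , (λ {q} {p} → ψ-selfInverse p q)
    }
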